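{- The $(\min,-)$ convolution of two vectors of length $n$ can be computed in $O(n\sqrt n)$ time in the nonuniform linear decision tree model.
   Context: For vectors $\vec x=\langle x_0,\dots,x_{n-1}\rangle$, $\vec y=\langle y_0,\dots,y_{n-1}\rangle$ of reals, the $(\min,-)$ convolution is the vector whose $k$th entry is $\min_{i=0}^{k}(x_i-y_{k-i})$, $k=0,\dots,n-1$. In the nonuniform linear decision tree model, for each input size there is a separate decision tree whose internal nodes test the sign of a linear function of the input values; the cost is the depth of the tree. -}

module Defs where

open import Algebra.Bundles using (CommutativeRing)
open import Data.Fin.Base using (Fin; zero; suc; toℕ; inject≤; opposite)
open import Data.Fin.Properties using (toℕ<n)
import Data.List.Base as List
open import Data.Nat.Base as ℕ using (ℕ; zero; suc)
open import Data.Product.Base using (_×_; _,_; ∃; ∃-syntax; proj₁)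
open import Data.Sum.Base using (inj₁; inj₂)
open import Data.Vec.Functional using (Vector; _++_; zipWith)
open import Function.Base using (_∘_)
open import Level using (0ℓ)
open import Relation.Binary.Bundles using (DecTotalOrder)
open import Relation.Binary.Core using (Rel)
open import Relation.Binary.Definitions using (tri<; tri≈; tri>)
open import Relation.Binary.Structures using (IsDecTotalOrder)
open import Relation.Nullary.Negation.Core using (¬_)
open import Relation.Unary using (Pred)

import Algebra.Definitions.RawMonoid as RawMonoidDefinitions
import Algebra.Properties.Ring as RingProperties
import Algebra.Properties.Group as GroupProperties
import Data.List.Extrema as Extrema
import Relation.Binary.Properties.DecTotalOrder as DecTotalOrderProperties
import Relation.Binary.Reasoning.PartialOrder as PartialOrderReasoning

-- The classical axioms of ℝ, which determine it up to isomorphism: a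
-- Dedekind-complete ordered field.  Equality is a setoid equality so that
-- constructions of ℝ as a quotient are models.

record Reals : Set₁ where
  field
    commutativeRing : CommutativeRing 0ℓ 0ℓ

  open CommutativeRing commutativeRing public hiding (zero)

  infix 4 _≤_
  field
    _≤_             : Rel Carrier 0ℓ
    isDecTotalOrder : IsDecTotalOrder _≈_ _≤_
    0≉1             : ¬ (0# ≈ 1#)
    inverse         : ∀ x → ¬ (x ≈ 0#) → ∃[ y ] x * y ≈ 1#
    +-monoˡ-≤       : ∀ z {x y} → x ≤ y → x + z ≤ y + z
    *-nonNegative   : ∀ {x y} → 0# ≤ x → 0# ≤ y → 0# ≤ x * y

  UpperBound : Pred Carrier 0ℓ → Pred Carrier 0ℓ
  UpperBound P b = ∀ x → P x → x ≤ b

  field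
    complete : ∀ (P : Pred Carrier 0ℓ) → ∃ P → ∃ (UpperBound P) →
               ∃[ s ] UpperBound P s × (∀ b → UpperBound P b → s ≤ b)

  decTotalOrder : DecTotalOrder 0ℓ 0ℓ 0ℓ
  decTotalOrder = record { isDecTotalOrder = isDecTotalOrder }

  open DecTotalOrder decTotalOrder public
    using (totalOrder; poset; _≤?_; _≟_)
    renaming ( refl to ≤-refl; reflexive to ≤-reflexive; trans to ≤-trans
             ; antisym to ≤-antisym; total to ≤-total
             ; ≤-respˡ-≈ to ≤-respˡ-≈; ≤-respʳ-≈ to ≤-respʳ-≈ )
  open DecTotalOrderProperties decTotalOrder public
    using (_<_; <-compare)

  fromℕ : ℕ → Carrier
  fromℕ n = n · 1#
    where open RawMonoidDefinitions +-rawMonoid renaming (_×_ to _·_)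

  sum : ∀ {n} → Vector Carrier n → Carrier
  sum = RawMonoidDefinitions.sum +-rawMonoid

module SquareRoot (ℝ : Reals) where
  open Reals ℝ
  open RingProperties ring using (-‿distribˡ-*; -‿distribʳ-*)
  open GroupProperties +-group using () renaming (⁻¹-involutive to -‿involutive)
  open PartialOrderReasoning poset

  private
    x≤y⇒0≤y-x : ∀ {x y} → x ≤ y → 0# ≤ y - x
    x≤y⇒0≤y-x {x} {y} x≤y = begin
      0#     ≈⟨ -‿inverseʳ x ⟨
      x - x  ≤⟨ +-monoˡ-≤ (- x) x≤y ⟩
      y - x  ∎

    0≤y-x⇒x≤y : ∀ {x y} → 0# ≤ y - x → x ≤ y
    0≤y-x⇒x≤y {x} {y} 0≤y-x = begin
      x              ≈⟨ +-identityˡ x ⟨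
      0# + x         ≤⟨ +-monoˡ-≤ x 0≤y-x ⟩
      (y - x) + x    ≈⟨ +-assoc y (- x) x ⟩
      y + (- x + x)  ≈⟨ +-congˡ (-‿inverseˡ x) ⟩
      y + 0#         ≈⟨ +-identityʳ y ⟩
      y              ∎

    0≤1 : 0# ≤ 1#
    0≤1 with ≤-total 0# 1#
    ... | inj₁ 0≤1 = 0≤1
    ... | inj₂ 1≤0 = begin
      0#             ≤⟨ *-nonNegative 0≤-1 0≤-1 ⟩
      - 1# * - 1#    ≈⟨ -‿distribˡ-* 1# (- 1#) ⟨
      - (1# * - 1#)  ≈⟨ -‿cong (*-identityˡ (- 1#)) ⟩
      - - 1#         ≈⟨ -‿involutive 1# ⟩
      1#             ∎
      where
      0≤-1 : 0# ≤ - 1#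
      0≤-1 = begin
        0#       ≤⟨ x≤y⇒0≤y-x 1≤0 ⟩
        0# - 1#  ≈⟨ +-identityˡ (- 1#) ⟩
        - 1#     ∎

    x≤1+x : ∀ x → x ≤ 1# + x
    x≤1+x x = begin
      x       ≈⟨ +-identityˡ x ⟨
      0# + x  ≤⟨ +-monoˡ-≤ x 0≤1 ⟩
      1# + x  ∎

    0≤fromℕ : ∀ n → 0# ≤ fromℕ n
    0≤fromℕ zero    = ≤-refl
    0≤fromℕ (suc n) = ≤-trans (0≤fromℕ n) (x≤1+x (fromℕ n))

    1≤1+fromℕ : ∀ n → 1# ≤ 1# + fromℕ n
    1≤1+fromℕ n = begin
      1#            ≈⟨ +-identityˡ 1# ⟨
      0# + 1#       ≤⟨ +-monoˡ-≤ 1# (0≤fromℕ n) ⟩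
      fromℕ n + 1#  ≈⟨ +-comm (fromℕ n) 1# ⟩
      1# + fromℕ n  ∎

    1≤t⇒t≤t² : ∀ {t} → 1# ≤ t → t ≤ t * t
    1≤t⇒t≤t² {t} 1≤t = 0≤y-x⇒x≤y (begin
      0#                ≤⟨ *-nonNegative (≤-trans 0≤1 1≤t) (x≤y⇒0≤y-x 1≤t) ⟩
      t * (t - 1#)      ≈⟨ distribˡ t t (- 1#) ⟩
      t * t + t * - 1#  ≈⟨ +-congˡ (-‿distribʳ-* t 1#) ⟨
      t * t - t * 1#    ≈⟨ +-congˡ (-‿cong (*-identityʳ t)) ⟩
      t * t - t         ∎)

  SquareAtMost : ℕ → Pred Carrier 0ℓ
  SquareAtMost n t = t * t ≤ fromℕ n

  squareAtMost-nonempty : ∀ n → ∃ (SquareAtMost n)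
  squareAtMost-nonempty n = 0# , (begin
    0# * 0#  ≈⟨ zeroˡ 0# ⟩
    0#       ≤⟨ 0≤fromℕ n ⟩
    fromℕ n  ∎)

  squareAtMost-bounded : ∀ n → ∃ (UpperBound (SquareAtMost n))
  squareAtMost-bounded n = 1# + fromℕ n , bound
    where
    bound : UpperBound (SquareAtMost n) (1# + fromℕ n)
    bound t t²≤n with ≤-total t 1#
    ... | inj₁ t≤1 = ≤-trans t≤1 (1≤1+fromℕ n)
    ... | inj₂ 1≤t = ≤-trans (1≤t⇒t≤t² 1≤t) (≤-trans t²≤n (x≤1+x (fromℕ n)))

  infix 8 √_
  √_ : ℕ → Carrier
  √ n = proj₁ (complete (SquareAtMost n) (squareAtMost-nonempty n)
                                         (squareAtMost-bounded n))

module Asymptotics (ℝ : Reals) where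
  open Reals ℝ

  infix 4 _∈O_
  _∈O_ : (ℕ → ℕ) → (ℕ → Carrier) → Set
  f ∈O g = ∃[ c ] ∃[ n₀ ] (∀ n → n₀ ℕ.≤ n → fromℕ (f n) ≤ c * g n)

module MinConvolution (ℝ : Reals) where
  open Reals ℝ

  minimum : ∀ {m} → Vector Carrier (suc m) → Carrier
  minimum f = Extrema.min totalOrder (f zero) (List.tabulate (f ∘ suc))

  -- For i : Fin (suc k), the value of opposite i is k - i.
  minusConvolution : ∀ {n} → Vector Carrier n → Vector Carrier n →
                     Vector Carrier n
  minusConvolution {n} x y k = minimum λ (i : Fin (suc (toℕ k))) →
    x (inject≤ i (toℕ<n k)) - y (inject≤ (opposite i) (toℕ<n k))

module LinearDecisionTree (ℝ : Reals) where
  open Reals ℝ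

  -- A homogeneous linear function of m variables, given by its coefficients.
  LinearForm : ℕ → Set
  LinearForm m = Vector Carrier m

  apply : ∀ {m} → LinearForm m → Vector Carrier m → Carrier
  apply a v = sum (zipWith _*_ a v)

  -- Trees with m real inputs and p real outputs.  A leaf must express each
  -- output as a fixed linear function of the inputs; an arbitrary function at
  -- a leaf would make every function computable at depth 0.
  data Tree (m p : ℕ) : Set where
    leaf : (output : Vector (LinearForm m) p) → Tree m p
    test : (a : LinearForm m) (negative zero positive : Tree m p) → Tree m p

  depth : ∀ {m p} → Tree m p → ℕ
  depth (leaf _)       = 0
  depth (test _ l e g) = suc (depth l ℕ.⊔ depth e ℕ.⊔ depth g)

  eval : ∀ {m p} → Tree m p → Vector Carrier m → Vector Carrier p
  eval (leaf output)  v j = apply (output j) v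
  eval (test a l e g) v with <-compare (apply a v) 0#
  ... | tri< _ _ _ = eval l v
  ... | tri≈ _ _ _ = eval e v
  ... | tri> _ _ _ = eval g v

  Computes₂ : ∀ {n p} → Tree (n ℕ.+ n) p →
              (Vector Carrier n → Vector Carrier n → Vector Carrier p) → Set
  Computes₂ t f = ∀ x y k → eval t (x ++ y) k ≈ f x y k

{-# OPTIONS --safe #-}

-- Fredman's trick reduces the comparison of x i - y (k - i) with x i′ - y (k - i′)
-- to the comparison of x i - x i′ with y (k - i) - y (k - i′).  Let s be about √ n.
-- Once the O(n s) differences x i - x i′ and y j - y j′ with indices less than s apart
-- are sorted, the minimum over every block of s consecutive i is known for every k,
-- and each output needs only s - 1 further tests to compare its s block minima.
--
-- The differences are linear forms in 2n variables, so their possible orders are the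
-- cells of an arrangement of polynomially many hyperplanes in dimension 2n: there are
-- at most 2 ^ O(n s) of them.  Insertion sort that queries the median of the orders
-- still possible therefore costs O(n s): each pair of tests either places an element
-- or halves the number of possible orders.

module Submission where

open import Defs
open import Data.Bool.Base using (Bool; true; false)
import Data.Bool.Properties as Bool
open import Data.Fin.Base
  using (Fin; zero; suc; toℕ; fromℕ<; inject≤; opposite; combine; remQuot; _↑ˡ_; _↑ʳ_)
open import Data.Fin.Properties
  using ( any?; toℕ<n; toℕ≤pred[n]; toℕ-fromℕ<; toℕ-inject≤; toℕ-injective
        ; opposite-prop; remQuot-combine )
open import Data.List.Base as List
  using (List; []; _∷_; length; _++_; last; head; filter; tabulate)
import Data.List.Extrema as Extrema
open import Data.List.Membership.Propositional using (_∈_; find; lose)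
open import Data.List.Membership.Propositional.Properties
  using (∈-map⁺; ∈-++⁺ˡ; ∈-++⁺ʳ; ∈-++⁻; ∈-filter⁺; ∈-tabulate⁺)
open import Data.List.Properties using (length-++; length-map; length-tabulate)
open import Data.List.Relation.Binary.Subset.Propositional using (_⊆_)
import Data.List.Relation.Unary.All as All
import Data.List.Relation.Unary.All.Properties as All
open import Data.List.Relation.Unary.Any as Any using (Any; here; there)
import Data.List.Relation.Unary.Any.Properties as Any
open import Data.List.Relation.Unary.Linked as Linked using (Linked; []; [-]; _∷_)
import Data.List.Relation.Unary.Linked.Properties as Linked
open import Data.Maybe.Base using (Maybe; just; nothing)
open import Data.Maybe.Relation.Binary.Connected
  using (Connected; just; just-nothing; nothing-just)
import Data.Maybe.Relation.Unary.All as Maybe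
open import Data.Nat.Base as ℕ using (ℕ; zero; suc)
open import Data.Nat.DivMod using (m≡m%n+[m/n]*n; m%n<n; m<n*o⇒m/o<n)
import Data.Nat.Properties as ℕ
open import Data.Nat.Solver using (module +-*-Solver)
open import Data.Product.Base using (_×_; _,_; ∃; ∃₂; ∃-syntax; Σ-syntax; proj₁; proj₂)
open import Data.Sum.Base using (_⊎_; inj₁; inj₂; [_,_]′)
open import Data.Unit.Base using (⊤; tt)
open import Data.Vec.Base as Vec using (Vec; []; _∷_)
import Data.Vec.Properties as Vec
open import Data.Vec.Functional as Vector using (Vector; zipWith; removeAt)
open import Data.Vec.Functional.Properties using (lookup-++ˡ; lookup-++ʳ)
open import Function.Base using (_∘_; id)
open import Level using (0ℓ)
open import Relation.Binary.Core using (Rel)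
open import Relation.Binary.Definitions using (tri<; tri≈; tri>; Reflexive; Transitive)
open import Relation.Binary.PropositionalEquality as ≡ using (_≡_)
open import Relation.Nullary using (Dec; ¬_; ¬?; yes; no; does; contradiction)
open import Relation.Nullary.Decidable using (decidable-stable; dec-true; dec-false)
open import Relation.Unary using (Pred; Decidable)

private
  variable
    A B : Set

-- Arithmetic and list preliminaries.

-- Induction step for the length of the list in `signVectors`: a new form adds to the old list two
-- copies of a list from one dimension lower. The sum is `(K + 2) * K ^ m`, and `K + 2` is the next
-- base.
cells-step : ∀ M m → let K = 1 ℕ.+ 2 ℕ.* M in
  K ℕ.^ suc m ℕ.+ (K ℕ.^ m ℕ.+ K ℕ.^ m) ℕ.≤ (1 ℕ.+ 2 ℕ.* suc M) ℕ.^ suc m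
cells-step M m = begin
  K ℕ.* L ℕ.+ (L ℕ.+ L)                   ≡⟨ solve 2 (λ M L →
    (con 1 :+ con 2 :* M) :* L :+ (L :+ L) := (con 1 :+ con 2 :* (con 1 :+ M)) :* L)
    ≡.refl M L ⟩
  (1 ℕ.+ 2 ℕ.* suc M) ℕ.* L               ≤⟨ ℕ.*-monoʳ-≤ (1 ℕ.+ 2 ℕ.* suc M)
    (ℕ.^-monoˡ-≤ m (ℕ.s≤s (ℕ.*-monoʳ-≤ 2 (ℕ.n≤1+n M)))) ⟩
  (1 ℕ.+ 2 ℕ.* suc M) ℕ.^ suc m           ∎
  where
  open ℕ.≤-Reasoning
  open +-*-Solver
  K L : ℕ
  K = 1 ℕ.+ 2 ℕ.* M
  L = K ℕ.^ m

-- `P` need not be monotone along the list: the cut falls before the first failure, and only its two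
-- neighbours are described. They are the only elements that `insertion` tests.
cut : {P : Pred A 0ℓ} → Decidable P → (l : List A) →
  ∃₂ λ pre post → l ≡ pre ++ post ×
    Maybe.All P (last pre) × Maybe.All (¬_ ∘ P) (head post)
cut P? [] = [] , [] , ≡.refl , Maybe.nothing , Maybe.nothing
cut P? (x ∷ l) with P? x
... | no ¬px = [] , x ∷ l , ≡.refl , Maybe.nothing , Maybe.just ¬px
... | yes px with cut P? l
...   | [] , post , ≡.refl , _ , heads = x ∷ [] , post , ≡.refl , Maybe.just px , heads
...   | y ∷ pre , post , ≡.refl , lasts , heads =
        x ∷ y ∷ pre , post , ≡.refl , lasts , heads

Linked-++⁻ : {R : Rel A 0ℓ} → ∀ xs {ys} → Linked R (xs ++ ys) → Linked R xs × Linked R ys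
Linked-++⁻ []           l       = [] , l
Linked-++⁻ (x ∷ [])     l       = [-] , Linked.tail l
Linked-++⁻ (x ∷ y ∷ xs) (r ∷ l) with Linked-++⁻ (y ∷ xs) l
... | lx , ly = r ∷ lx , ly

insert-⊆ : ∀ (e : A) pre {post} → e ∷ pre ++ post ⊆ pre ++ e ∷ post
insert-⊆ e pre (here eq)  = ∈-++⁺ʳ pre (here eq)
insert-⊆ e pre (there x∈) = [ ∈-++⁺ˡ , ∈-++⁺ʳ pre ∘ there ]′ (∈-++⁻ pre x∈)

-- The order of x and y is read off the list, the same for every preorder R.
Linked-compare : ∀ (l : List A) {x y} → x ∈ l → y ∈ l →
  (∀ (R : Rel A 0ℓ) → Reflexive R → Transitive R → Linked R l → R x y) ⊎
  (∀ (R : Rel A 0ℓ) → Reflexive R → Transitive R → Linked R l → R y x)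
Linked-compare l (here ≡.refl) y∈l = inj₁ λ R refl trans linked →
  All.lookup (Linked.Linked⇒All {R = R} trans refl linked) y∈l
Linked-compare l x∈l@(there _) (here ≡.refl) = inj₂ λ R refl trans linked →
  All.lookup (Linked.Linked⇒All {R = R} trans refl linked) x∈l
Linked-compare (_ ∷ l) (there x∈l) (there y∈l) with Linked-compare l x∈l y∈l
... | inj₁ Rxy = inj₁ λ R refl trans linked → Rxy R refl trans (Linked.tail linked)
... | inj₂ Ryx = inj₂ λ R refl trans linked → Ryx R refl trans (Linked.tail linked)

length-filter-true-false : ∀ (f : A → Bool) l →
  length (filter (λ x → f x Bool.≟ true) l) ℕ.+
  length (filter (λ x → f x Bool.≟ false) l) ≡ length l
length-filter-true-false f [] = ≡.refl
length-filter-true-false f (x ∷ l) with f x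
... | true  = ≡.cong suc (length-filter-true-false f l)
... | false = ≡.trans (ℕ.+-suc _ _) (≡.cong suc (length-filter-true-false f l))

integerSqrt : ∀ n → ∃[ t ] t ℕ.* t ℕ.≤ n × n ℕ.< suc t ℕ.* suc t
integerSqrt zero = 0 , ℕ.z≤n , ℕ.s≤s ℕ.z≤n
integerSqrt (suc n) with t , t²≤n , n<[1+t]² ← integerSqrt n
  with suc n ℕ.<? suc t ℕ.* suc t
... | yes 1+n<[1+t]² = t , ℕ.m≤n⇒m≤1+n t²≤n , 1+n<[1+t]²
... | no  1+n≮[1+t]² = suc t , ℕ.≮⇒≥ 1+n≮[1+t]² , ℕ.≤-<-trans n<[1+t]²
  (ℕ.*-mono-< (ℕ.n<1+n (suc t)) (ℕ.n<1+n (suc t)))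

n≤2^n : ∀ n → n ℕ.≤ 2 ℕ.^ n
n≤2^n zero    = ℕ.z≤n
n≤2^n (suc n) = ℕ.≤-trans (ℕ.+-mono-≤ (ℕ.m^n>0 2 n) (n≤2^n n))
  (ℕ.≤-reflexive (≡.cong (2 ℕ.^ n ℕ.+_) (≡.sym (ℕ.+-identityʳ (2 ℕ.^ n)))))

double-≤-2^ : ∀ {a} p → a ℕ.≤ 2 ℕ.^ p → a ℕ.+ a ℕ.≤ 2 ℕ.^ suc p
double-≤-2^ p a≤ = ℕ.≤-trans (ℕ.+-mono-≤ a≤ a≤)
  (ℕ.≤-reflexive (≡.cong (2 ℕ.^ p ℕ.+_) (≡.sym (ℕ.+-identityʳ (2 ℕ.^ p)))))

square-≤-2^ : ∀ {a} p → a ℕ.≤ 2 ℕ.^ p → a ℕ.* a ℕ.≤ 2 ℕ.^ (p ℕ.+ p)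
square-≤-2^ p a≤ = ℕ.≤-trans (ℕ.*-mono-≤ a≤ a≤) (ℕ.≤-reflexive (≡.sym (ℕ.^-distribˡ-+-* 2 p p)))

-- Number of orders and total cost.

pairs : ℕ → ℕ
pairs n = (n ℕ.+ n) ℕ.* (n ℕ.+ n)

-- Exponent bounding the number of orders. From `n ≤ s * s` and `s ≤ 2 ^ s` follow `n + n ≤ 2 ^ p`,
-- `pairs n ≤ 2 ^ q` and `1 + 2 * (pairs n * pairs n) ≤ 2 ^ (2 + (q + q))`; the dimension `n +
-- n` multiplies the exponent, and the outer `suc` makes the bound strict.
entropy : ℕ → ℕ → ℕ
entropy n s = suc (suc (suc (q ℕ.+ q)) ℕ.* (n ℕ.+ n))
  where
  p q : ℕ
  p = suc (s ℕ.+ s)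
  q = p ℕ.+ p

cells<2^entropy : ∀ n s → n ℕ.≤ s ℕ.* s →
  (1 ℕ.+ 2 ℕ.* (pairs n ℕ.* pairs n)) ℕ.^ (n ℕ.+ n) ℕ.< 2 ℕ.^ entropy n s
cells<2^entropy n s n≤s² = ℕ.≤-<-trans
  (ℕ.≤-trans (ℕ.^-monoˡ-≤ (n ℕ.+ n) cells-1)
             (ℕ.≤-reflexive (ℕ.^-*-assoc 2 (suc (suc (q ℕ.+ q))) (n ℕ.+ n))))
  (ℕ.^-monoʳ-< 2 (ℕ.s≤s (ℕ.s≤s ℕ.z≤n)) (ℕ.n<1+n (suc (suc (q ℕ.+ q)) ℕ.* (n ℕ.+ n))))
  where
  p q a : ℕ
  p = suc (s ℕ.+ s)
  q = p ℕ.+ p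
  a = pairs n ℕ.* pairs n

  a≤ : a ℕ.≤ 2 ℕ.^ (q ℕ.+ q)
  a≤ = square-≤-2^ q (square-≤-2^ p (double-≤-2^ (s ℕ.+ s)
         (ℕ.≤-trans n≤s² (square-≤-2^ s (n≤2^n s)))))

  cells-1 : 1 ℕ.+ 2 ℕ.* a ℕ.≤ 2 ℕ.^ suc (suc (q ℕ.+ q))
  cells-1 = ℕ.≤-trans
    (ℕ.+-mono-≤ (ℕ.m^n>0 2 (suc (q ℕ.+ q))) (ℕ.*-monoʳ-≤ 2 a≤))
    (ℕ.≤-reflexive (≡.cong (2 ℕ.^ suc (q ℕ.+ q) ℕ.+_) (≡.sym (ℕ.+-identityʳ _))))

cost : ℕ → ℕ → ℕ
cost n t = (n ℕ.* (s ℕ.+ s) ℕ.+ n ℕ.* (s ℕ.+ s) ℕ.+ entropy n s) ℕ.* 2 ℕ.+ n ℕ.* t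
  where
  s : ℕ
  s = suc t

-- Expanded, `cost n t` is `41 * n * t + 64 * n + 2`, and 107 is 41 + 64 + 2. Substituting `1 + n`
-- and `1 + t` makes the slack a polynomial without subtraction.
cost≤ : ∀ n t → 1 ℕ.≤ n → 1 ℕ.≤ t → cost n t ℕ.≤ 107 ℕ.* (n ℕ.* t)
cost≤ (suc n) (suc t) _ _ = ℕ.m+n≤o⇒m≤o (cost (suc n) (suc t)) (ℕ.≤-reflexive
  (solve 2 (λ n t → :cost (con 1 :+ n) (con 1 :+ t) :+
                    (con 66 :* n :* t :+ con 2 :* n :+ con 66 :* t)
                    := con 107 :* ((con 1 :+ n) :* (con 1 :+ t))) ≡.refl n t))
  where
  open +-*-Solver
  :entropy :cost : ∀ {v} → Polynomial v → Polynomial v → Polynomial v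
  :entropy n s = con 1 :+ (con 2 :+ (q :+ q)) :* (n :+ n)
    where
    p = con 1 :+ (s :+ s)
    q = p :+ p
  :cost n t = (n :* (s :+ s) :+ n :* (s :+ s) :+ :entropy n s) :* con 2 :+ n :* t
    where
    s = con 1 :+ t

-- Nearby indices and blocks.

Near : ℕ → ℕ → ℕ → Set
Near s a b = a ℕ.< b ℕ.+ s × b ℕ.< a ℕ.+ s

Near-⊓ : ∀ {s a b} k → 0 ℕ.< s → Near s a b → Near s (a ℕ.⊓ k) (b ℕ.⊓ k)
Near-⊓ {s} k 0<s (a< , b<) = step a< , step b<
  where
  step : ∀ {a b} → a ℕ.< b ℕ.+ s → a ℕ.⊓ k ℕ.< b ℕ.⊓ k ℕ.+ s
  step {a} {b} a< = ≡.subst (a ℕ.⊓ k ℕ.<_) (≡.sym (ℕ.+-distribʳ-⊓ s b k))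
    (ℕ.⊓-mono-< a< (ℕ.m<m+n k 0<s))

-- Reflection in `k` preserves distances and swaps the two inequalities. It carries nearness of `x`
-- indices over to the matching `y` indices.
Near-∸ : ∀ {s a b k} → a ℕ.≤ k → b ℕ.≤ k → Near s a b → Near s (k ℕ.∸ a) (k ℕ.∸ b)
Near-∸ {s} {a} {b} {k} a≤k b≤k (a< , b<) = step a≤k b≤k b< , step b≤k a≤k a<
  where
  step : ∀ {a b} → a ℕ.≤ k → b ℕ.≤ k → b ℕ.< a ℕ.+ s → k ℕ.∸ a ℕ.< (k ℕ.∸ b) ℕ.+ s
  step {a} {b} a≤k b≤k b< = ℕ.+-cancelˡ-< b _ _ (ℕ.+-cancelˡ-< a _ _ (begin-strict
    a ℕ.+ (b ℕ.+ (k ℕ.∸ a))          ≡⟨ ℕ.+-comm a _ ⟩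
    b ℕ.+ (k ℕ.∸ a) ℕ.+ a            ≡⟨ ℕ.+-assoc b _ a ⟩
    b ℕ.+ (k ℕ.∸ a ℕ.+ a)            ≡⟨ ≡.cong (b ℕ.+_) (ℕ.m∸n+n≡m a≤k) ⟩
    b ℕ.+ k                          <⟨ ℕ.+-monoˡ-< k b< ⟩
    a ℕ.+ s ℕ.+ k                    ≡⟨ ℕ.+-assoc a s k ⟩
    a ℕ.+ (s ℕ.+ k)                  ≡⟨ ≡.cong (a ℕ.+_) (ℕ.+-comm s k) ⟩
    a ℕ.+ (k ℕ.+ s)                  ≡⟨ ≡.cong (λ k → a ℕ.+ (k ℕ.+ s)) (ℕ.m+[n∸m]≡n b≤k) ⟨
    a ℕ.+ (b ℕ.+ (k ℕ.∸ b) ℕ.+ s)    ≡⟨ ≡.cong (a ℕ.+_) (ℕ.+-assoc b _ s) ⟩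
    a ℕ.+ (b ℕ.+ ((k ℕ.∸ b) ℕ.+ s))  ∎))
    where open ℕ.≤-Reasoning

module _ {n : ℕ} where

  clip : Fin n → ℕ → Fin n
  clip i j with j ℕ.<? n
  ... | yes j<n = fromℕ< j<n
  ... | no  _   = i

  clip-toℕ : ∀ i j → clip i (toℕ j) ≡ j
  clip-toℕ i j with toℕ j ℕ.<? n
  ... | yes j<n = toℕ-injective (toℕ-fromℕ< j<n)
  ... | no  j≮n = contradiction (toℕ<n j) j≮n

  -- The offset d stands for the index i + d - s, or for i itself if that exceeds n - 1;
  -- truncated subtraction only adds superfluous pairs.
  nearPair : ∀ s → Fin n × Fin (s ℕ.+ s) → Fin n × Fin n
  nearPair s (i , d) = i , clip i (toℕ i ℕ.+ toℕ d ℕ.∸ s)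

  nearPairs : ℕ → List (Fin n × Fin n)
  nearPairs s = tabulate (nearPair s ∘ remQuot {n} (s ℕ.+ s))

  length-nearPairs : ∀ s → length (nearPairs s) ≡ n ℕ.* (s ℕ.+ s)
  length-nearPairs s = length-tabulate (nearPair s ∘ remQuot {n} (s ℕ.+ s))

  ∈-nearPairs : ∀ s {i j} → Near s (toℕ i) (toℕ j) → (i , j) ∈ nearPairs s
  ∈-nearPairs s {i} {j} (i< , j<) = ≡.subst (_∈ nearPairs s)
    (≡.trans (≡.cong (nearPair s) (remQuot-combine i d)) (≡.cong (i ,_)
      (≡.trans (≡.cong (clip i) shift) (clip-toℕ i j))))
    (∈-tabulate⁺ {f = nearPair s ∘ remQuot {n} (s ℕ.+ s)} (combine i d))
    where
    d<s+s : toℕ j ℕ.+ s ℕ.∸ toℕ i ℕ.< s ℕ.+ s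
    d<s+s = ≡.subst (toℕ j ℕ.+ s ℕ.∸ toℕ i ℕ.<_)
      (≡.trans (≡.cong (ℕ._∸ toℕ i) (ℕ.+-assoc (toℕ i) s s)) (ℕ.m+n∸m≡n (toℕ i) (s ℕ.+ s)))
      (ℕ.∸-monoˡ-< (ℕ.+-monoˡ-< s j<) (ℕ.<⇒≤ i<))

    d : Fin (s ℕ.+ s)
    d = fromℕ< d<s+s

    shift : toℕ i ℕ.+ toℕ d ℕ.∸ s ≡ toℕ j
    shift = ≡.trans (≡.cong (λ d → toℕ i ℕ.+ d ℕ.∸ s) (toℕ-fromℕ< d<s+s))
      (≡.trans (≡.cong (ℕ._∸ s) (ℕ.m+[n∸m]≡n (ℕ.<⇒≤ i<))) (ℕ.m+n∸n≡m (toℕ j) s))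

-- Blocks are made full by replacing every index beyond k by k.
module _ {k s : ℕ} where

  block : Fin s → Fin s → Fin (suc k)
  block q r = fromℕ< (ℕ.s≤s (ℕ.m⊓n≤n (toℕ q ℕ.* s ℕ.+ toℕ r) k))

  toℕ-block : ∀ q r → toℕ (block q r) ≡ (toℕ q ℕ.* s ℕ.+ toℕ r) ℕ.⊓ k
  toℕ-block q r = toℕ-fromℕ< (ℕ.s≤s (ℕ.m⊓n≤n (toℕ q ℕ.* s ℕ.+ toℕ r) k))

  block-near : ∀ q r r′ → Near s (toℕ (block q r)) (toℕ (block q r′))
  block-near q r r′ = ≡.subst₂ (Near s) (≡.sym (toℕ-block q r)) (≡.sym (toℕ-block q r′))
    (Near-⊓ k (ℕ.≤-<-trans ℕ.z≤n (toℕ<n r)) (step r r′ , step r′ r))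
    where
    step : ∀ r r′ → toℕ q ℕ.* s ℕ.+ toℕ r ℕ.< toℕ q ℕ.* s ℕ.+ toℕ r′ ℕ.+ s
    step r r′ = ≡.subst (toℕ q ℕ.* s ℕ.+ toℕ r ℕ.<_)
      (≡.sym (ℕ.+-assoc (toℕ q ℕ.* s) (toℕ r′) s))
      (ℕ.+-monoʳ-< (toℕ q ℕ.* s) (ℕ.<-≤-trans (toℕ<n r) (ℕ.m≤n+m s (toℕ r′))))

  -- Quotient and remainder of `i` by `s` give block and position: `i < s * s` keeps the quotient
  -- below `s`, and `i ≤ k` makes the clamping harmless.
  block-surjective : .{{_ : ℕ.NonZero s}} → k ℕ.< s ℕ.* s → ∀ i → ∃[ q ] ∃[ r ] block q r ≡ i
  block-surjective k<s² i = q , r , toℕ-injective (begin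
    toℕ (block q r)
      ≡⟨ toℕ-block q r ⟩
    (toℕ q ℕ.* s ℕ.+ toℕ r) ℕ.⊓ k
      ≡⟨ ≡.cong (ℕ._⊓ k) (≡.cong₂ (λ q r → q ℕ.* s ℕ.+ r)
           (toℕ-fromℕ< q<s) (toℕ-fromℕ< (m%n<n (toℕ i) s))) ⟩
    (toℕ i ℕ./ s ℕ.* s ℕ.+ toℕ i ℕ.% s) ℕ.⊓ k
      ≡⟨ ≡.cong (ℕ._⊓ k) (≡.trans (ℕ.+-comm _ (toℕ i ℕ.% s))
                                  (≡.sym (m≡m%n+[m/n]*n (toℕ i) s))) ⟩
    toℕ i ℕ.⊓ k
      ≡⟨ ℕ.m≤n⇒m⊓n≡m (toℕ≤pred[n] i) ⟩
    toℕ i ∎)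
    where
    open ≡.≡-Reasoning
    q<s : toℕ i ℕ./ s ℕ.< s
    q<s = m<n*o⇒m/o<n (ℕ.≤-<-trans (toℕ≤pred[n] i) k<s²)
    q r : Fin s
    q = fromℕ< q<s
    r = fromℕ< (m%n<n (toℕ i) s)

module _ (ℝ : Reals) where
  open Reals ℝ
  open SquareRoot ℝ
  open MinConvolution ℝ
  open LinearDecisionTree ℝ
  open import Algebra.Properties.CommutativeMonoid.Sum +-commutativeMonoid
    using (sum-remove; ∑-distrib-+; sum-cong-≋; sum-replicate-zero)
  open import Algebra.Properties.Semiring.Sum semiring using (*-distribˡ-sum)
  open import Algebra.Properties.CommutativeSemigroup *-commutativeSemigroup
    using (x∙yz≈y∙xz)
  open import Algebra.Properties.Ring ring
    using (-1*x≈-x; -‿distribˡ-*; x[y-z]≈xy-xz)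
  open import Algebra.Properties.Semiring.Mult semiring using (×1-homo-*)
  open import Algebra.Properties.Group +-group
    using () renaming (⁻¹-involutive to -‿involutive)
  open import Relation.Binary.Reasoning.PartialOrder poset

  private
    variable
      m M : ℕ
      x y x′ y′ α β : Carrier

  -- Ordered field arithmetic and weak excluded middle.

  ≤⇒-≤0 : x ≤ y → x - y ≤ 0#
  ≤⇒-≤0 {x} {y} x≤y = begin
    x - y  ≤⟨ +-monoˡ-≤ (- y) x≤y ⟩
    y - y  ≈⟨ -‿inverseʳ y ⟩
    0#     ∎

  -≤0⇒≤ : x - y ≤ 0# → x ≤ y
  -≤0⇒≤ {x} {y} x-y≤0 = begin
    x              ≈⟨ +-identityʳ x ⟨
    x + 0#         ≈⟨ +-congˡ (-‿inverseˡ y) ⟨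
    x + (- y + y)  ≈⟨ +-assoc x (- y) y ⟨
    (x - y) + y    ≤⟨ +-monoˡ-≤ y x-y≤0 ⟩
    0# + y         ≈⟨ +-identityˡ y ⟩
    y              ∎

  0≤⇒-≤0 : 0# ≤ x → - x ≤ 0#
  0≤⇒-≤0 {x} 0≤x = ≤-respˡ-≈ (+-identityˡ (- x)) (≤⇒-≤0 0≤x)

  ≤0⇒0≤- : x ≤ 0# → 0# ≤ - x
  ≤0⇒0≤- {x} x≤0 = begin
    0#      ≈⟨ -‿inverseʳ x ⟨
    x - x   ≤⟨ +-monoˡ-≤ (- x) x≤0 ⟩
    0# - x  ≈⟨ +-identityˡ (- x) ⟩
    - x     ∎

  +-mono-≤ : x ≤ y → x′ ≤ y′ → x + x′ ≤ y + y′
  +-mono-≤ {x} {y} {x′} {y′} x≤y x′≤y′ = begin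
    x + x′  ≤⟨ +-monoˡ-≤ x′ x≤y ⟩
    y + x′  ≈⟨ +-comm y x′ ⟩
    x′ + y  ≤⟨ +-monoˡ-≤ y x′≤y′ ⟩
    y′ + y  ≈⟨ +-comm y′ y ⟩
    y + y′  ∎

  *-nonPositive : 0# ≤ α → x ≤ 0# → α * x ≤ 0#
  *-nonPositive {α} {x} 0≤α x≤0 = begin
    α * x            ≈⟨ -‿involutive (α * x) ⟨
    - - (α * x)      ≤⟨ 0≤⇒-≤0 0≤-αx ⟩
    0#               ∎
    where
    0≤-αx : 0# ≤ - (α * x)
    0≤-αx = begin
      0#         ≤⟨ *-nonNegative 0≤α (≤0⇒0≤- x≤0) ⟩
      α * - x    ≈⟨ *-comm α (- x) ⟩
      - x * α    ≈⟨ -‿distribˡ-* x α ⟨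
      - (x * α)  ≈⟨ -‿cong (*-comm x α) ⟩
      - (α * x)  ∎

  *-cancel-≤0 : 0# ≤ α → ¬ α ≈ 0# → α * x ≤ 0# → x ≤ 0#
  *-cancel-≤0 {α} {x} 0≤α α≉0 αx≤0 with ≤-total x 0# | inverse α α≉0
  ... | inj₁ x≤0 | _ = x≤0
  ... | inj₂ 0≤x | α⁻¹ , αα⁻¹≈1 = ≤-reflexive (begin-equality
    x                ≈⟨ *-identityˡ x ⟨
    1# * x           ≈⟨ *-congʳ (trans (*-comm α⁻¹ α) αα⁻¹≈1) ⟨
    (α⁻¹ * α) * x    ≈⟨ *-assoc α⁻¹ α x ⟩
    α⁻¹ * (α * x)    ≈⟨ *-congˡ (≤-antisym αx≤0 (*-nonNegative 0≤α 0≤x)) ⟩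
    α⁻¹ * 0#         ≈⟨ zeroʳ α⁻¹ ⟩
    0#               ∎)

  0≤1 : 0# ≤ 1#
  0≤1 with ≤-total 0# 1#
  ... | inj₁ 0≤1 = 0≤1
  ... | inj₂ 1≤0 = begin
    0#           ≤⟨ *-nonNegative (≤0⇒0≤- 1≤0) (≤0⇒0≤- 1≤0) ⟩
    - 1# * - 1#  ≈⟨ -1*x≈-x (- 1#) ⟩
    - - 1#       ≈⟨ -‿involutive 1# ⟩
    1#           ∎

  -- Completeness together with the decidability of ≤ yields weak excluded
  -- middle: compare the supremum of {0} ∪ {1 ∣ A} with 0.
  weak-excluded-middle : (A : Set) → ¬ A ⊎ ¬ ¬ A
  weak-excluded-middle A = compare (complete P (0# , inj₁ refl) (1# , λ
      { x (inj₁ x≈0)       → ≤-respˡ-≈ (sym x≈0) 0≤1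
      ; x (inj₂ (x≈1 , _)) → ≤-reflexive x≈1 }))
    where
    P : Carrier → Set
    P x = x ≈ 0# ⊎ (x ≈ 1# × A)

    compare : ∃[ s ] UpperBound P s × (∀ b → UpperBound P b → s ≤ b) → ¬ A ⊎ ¬ ¬ A
    compare (s , upper , least) with s ≤? 0#
    ... | yes s≤0 = inj₁ λ a →
      0≉1 (≤-antisym 0≤1 (≤-trans (upper 1# (inj₂ (refl , a))) s≤0))
    ... | no s≰0 = inj₂ λ ¬a → s≰0 (least 0# λ
      { x (inj₁ x≈0)     → ≤-reflexive x≈0
      ; x (inj₂ (_ , a)) → contradiction a ¬a })

  -- Linear forms.

  combination : Carrier → Vector Carrier m → Carrier → Vector Carrier m →
                Vector Carrier m
  combination α a β b i = α * a i + β * b i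

  apply-combinationʳ : ∀ (a : LinearForm m) α v β w →
    apply a (combination α v β w) ≈ α * apply a v + β * apply a w
  apply-combinationʳ a α v β w = begin-equality
    sum (λ i → a i * (α * v i + β * w i))
      ≈⟨ sum-cong-≋ (λ i → trans (distribˡ (a i) _ _)
                     (+-cong (x∙yz≈y∙xz _ _ _) (x∙yz≈y∙xz _ _ _))) ⟩
    sum (λ i → α * (a i * v i) + β * (a i * w i))
      ≈⟨ ∑-distrib-+ (λ i → α * (a i * v i)) (λ i → β * (a i * w i)) ⟩
    sum (λ i → α * (a i * v i)) + sum (λ i → β * (a i * w i))
      ≈⟨ +-cong (*-distribˡ-sum α (zipWith _*_ a v))
                (*-distribˡ-sum β (zipWith _*_ a w)) ⟨
    α * apply a v + β * apply a w ∎

  apply-comm : ∀ (a v : Vector Carrier m) → apply a v ≈ apply v a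
  apply-comm a v = sum-cong-≋ (λ i → *-comm (a i) (v i))

  apply-combinationˡ : ∀ α (a : LinearForm m) β b v →
    apply (combination α a β b) v ≈ α * apply a v + β * apply b v
  apply-combinationˡ α a β b v = begin-equality
    apply (combination α a β b) v   ≈⟨ apply-comm (combination α a β b) v ⟩
    apply v (combination α a β b)   ≈⟨ apply-combinationʳ v α a β b ⟩
    α * apply v a + β * apply v b   ≈⟨ +-cong (*-congˡ (apply-comm v a))
                                              (*-congˡ (apply-comm v b)) ⟩
    α * apply a v + β * apply b v   ∎

  apply-0 : ∀ (a : LinearForm m) v → (∀ i → a i ≈ 0#) → apply a v ≈ 0#
  apply-0 {m} a v a≈0 = trans
    (sum-cong-≋ (λ i → trans (*-congʳ (a≈0 i)) (zeroˡ (v i))))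
    (sum-replicate-zero m)

  infixl 6 _⊝_
  _⊝_ : LinearForm m → LinearForm m → LinearForm m
  a ⊝ b = combination 1# a (- 1#) b

  apply-⊝ : ∀ (a b : LinearForm m) v → apply (a ⊝ b) v ≈ apply a v - apply b v
  apply-⊝ a b v = trans (apply-combinationˡ 1# a (- 1#) b v)
                        (+-cong (*-identityˡ _) (-1*x≈-x _))

  ≤⇒apply-⊝-≤0 : ∀ (a b : LinearForm m) v → apply a v ≤ apply b v → apply (a ⊝ b) v ≤ 0#
  ≤⇒apply-⊝-≤0 a b v le = ≤-respˡ-≈ (sym (apply-⊝ a b v)) (≤⇒-≤0 le)

  apply-⊝-≤0⇒≤ : ∀ (a b : LinearForm m) v → apply (a ⊝ b) v ≤ 0# → apply a v ≤ apply b v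
  apply-⊝-≤0⇒≤ a b v le = -≤0⇒≤ (≤-respˡ-≈ (apply-⊝ a b v) le)

  unit : Fin m → LinearForm m
  unit zero    = 1# Vector.∷ λ _ → 0#
  unit (suc i) = 0# Vector.∷ unit i

  apply-unit : ∀ (i : Fin m) v → apply (unit i) v ≈ v i
  apply-unit zero v = trans
    (+-cong (*-identityˡ _) (apply-0 (λ _ → 0#) (Vector.tail v) (λ _ → refl)))
    (+-identityʳ _)
  apply-unit (suc i) v = trans
    (+-cong (zeroˡ _) (apply-unit i (Vector.tail v)))
    (+-identityˡ _)

  -- Sign vectors of families of linear forms.

  nonPositive : LinearForm m → Vector Carrier m → Bool
  nonPositive a v = does (apply a v ≤? 0#)

  signs : Vec (LinearForm m) M → Vector Carrier m → Vec Bool M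
  signs as v = Vec.map (λ a → nonPositive a v) as

  nonPositive-true : ∀ (a : LinearForm m) v → apply a v ≤ 0# → nonPositive a v ≡ true
  nonPositive-true a v = dec-true (apply a v ≤? 0#)

  nonPositive-true⁻ : ∀ (a : LinearForm m) v → nonPositive a v ≡ true → apply a v ≤ 0#
  nonPositive-true⁻ a v eq with yes p ← apply a v ≤? 0# = p

  nonPositive-false : ∀ (a : LinearForm m) v → ¬ apply a v ≤ 0# → nonPositive a v ≡ false
  nonPositive-false a v = dec-false (apply a v ≤? 0#)

  nonPositive-false⁻ : ∀ (a : LinearForm m) v → nonPositive a v ≡ false → ¬ apply a v ≤ 0#
  nonPositive-false⁻ a v eq with no p ← apply a v ≤? 0# = p

  nonPositive-cong : ∀ {n} (a : LinearForm m) v (b : LinearForm n) w →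
                     apply a v ≈ apply b w → nonPositive a v ≡ nonPositive b w
  nonPositive-cong a v b w eq with apply b w ≤? 0#
  ... | yes p = nonPositive-true a v (≤-respˡ-≈ (sym eq) p)
  ... | no ¬p = nonPositive-false a v (λ p → ¬p (≤-respˡ-≈ eq p))

  -- Both sign classes are closed under addition and positive scaling. The strict class needs a
  -- nonzero `α`, since `β` may vanish.
  nonPositive-combination : ∀ (a : LinearForm m) {α β} v w →
    0# ≤ α → ¬ α ≈ 0# → 0# ≤ β → nonPositive a v ≡ nonPositive a w →
    nonPositive a (combination α v β w) ≡ nonPositive a v
  nonPositive-combination a {α} {β} v w 0≤α α≉0 0≤β eq
    with apply a v ≤? 0# | apply a w ≤? 0#
  ... | yes av≤0 | yes aw≤0 = nonPositive-true a (combination α v β w) (begin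
    apply a (combination α v β w)  ≈⟨ apply-combinationʳ a α v β w ⟩
    α * apply a v + β * apply a w  ≤⟨ +-mono-≤ (*-nonPositive 0≤α av≤0)
                                               (*-nonPositive 0≤β aw≤0) ⟩
    0# + 0#                        ≈⟨ +-identityˡ 0# ⟩
    0#                             ∎)
  ... | no av≰0 | no aw≰0 with ≤-total 0# (apply a w)
  ...   | inj₂ aw≤0 = contradiction aw≤0 aw≰0
  ...   | inj₁ 0≤aw = nonPositive-false a (combination α v β w) λ z≤0 →
    av≰0 (*-cancel-≤0 0≤α α≉0 (begin
      α * apply a v                  ≈⟨ +-identityʳ _ ⟨
      α * apply a v + 0#             ≤⟨ +-mono-≤ ≤-refl (*-nonNegative 0≤β 0≤aw) ⟩
      α * apply a v + β * apply a w  ≈⟨ apply-combinationʳ a α v β w ⟨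
      apply a (combination α v β w)  ≤⟨ z≤0 ⟩
      0#                             ∎))

  signs-combination : ∀ (as : Vec (LinearForm m) M) {α β} v w →
    0# ≤ α → ¬ α ≈ 0# → 0# ≤ β → signs as v ≡ signs as w →
    signs as (combination α v β w) ≡ signs as v
  signs-combination []       v w 0≤α α≉0 0≤β eq = ≡.refl
  signs-combination (a ∷ as) v w 0≤α α≉0 0≤β eq = ≡.cong₂ _∷_
    (nonPositive-combination a v w 0≤α α≉0 0≤β (Vec.∷-injectiveˡ eq))
    (signs-combination as v w 0≤α α≉0 0≤β (Vec.∷-injectiveʳ eq))

  module _ (f : LinearForm (suc m)) (p : Fin (suc m)) (c : Carrier)
           (fp*c≈1 : f p * c ≈ 1#) where

    private
      subtract : LinearForm (suc m) → LinearForm (suc m)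
      subtract a = combination 1# a (- (a p * c)) f

      subtract-p : ∀ a → subtract a p ≈ 0#
      subtract-p a = begin-equality
        1# * a p + - (a p * c) * f p
          ≈⟨ +-cong (*-identityˡ (a p)) (sym (-‿distribˡ-* (a p * c) (f p))) ⟩
        a p - a p * c * f p
          ≈⟨ +-congˡ (-‿cong (*-assoc (a p) c (f p))) ⟩
        a p - a p * (c * f p)
          ≈⟨ +-congˡ (-‿cong (*-congˡ (trans (*-comm c (f p)) fp*c≈1))) ⟩
        a p - a p * 1#
          ≈⟨ +-congˡ (-‿cong (*-identityʳ (a p))) ⟩
        a p - a p
          ≈⟨ -‿inverseʳ (a p) ⟩
        0# ∎

    -- Gaussian elimination with pivot `f p`: subtracting a multiple of `f` clears coefficient `p`
    -- and changes nothing where `f` vanishes. On that hyperplane every form thus becomes a form in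
    -- one variable fewer.
    eliminate : LinearForm (suc m) → LinearForm m
    eliminate a = removeAt (subtract a) p

    apply-eliminate : ∀ a z → apply f z ≈ 0# →
                      apply (eliminate a) (removeAt z p) ≈ apply a z
    apply-eliminate a z fz≈0 = begin-equality
      apply (eliminate a) (removeAt z p)
        ≈⟨ +-identityˡ _ ⟨
      0# + apply (eliminate a) (removeAt z p)
        ≈⟨ +-congʳ (trans (*-congʳ (subtract-p a)) (zeroˡ (z p))) ⟨
      subtract a p * z p + apply (eliminate a) (removeAt z p)
        ≈⟨ sum-remove {i = p} (zipWith _*_ (subtract a) z) ⟨
      apply (subtract a) z
        ≈⟨ apply-combinationˡ 1# a (- (a p * c)) f z ⟩
      1# * apply a z + - (a p * c) * apply f z
        ≈⟨ +-cong (*-identityˡ _) (trans (*-congˡ fz≈0) (zeroʳ _)) ⟩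
      apply a z + 0#
        ≈⟨ +-identityʳ _ ⟩
      apply a z ∎

    signs-eliminate : ∀ (as : Vec (LinearForm (suc m)) M) z → apply f z ≈ 0# →
      signs (Vec.map eliminate as) (removeAt z p) ≡ signs as z
    signs-eliminate []       z fz≈0 = ≡.refl
    signs-eliminate (a ∷ as) z fz≈0 = ≡.cong₂ _∷_
      (nonPositive-cong (eliminate a) (removeAt z p) a z (apply-eliminate a z fz≈0))
      (signs-eliminate as z fz≈0)

  private
    _∈?_ : (σ : Vec Bool M) (G : List (Vec Bool M)) → Dec (σ ∈ G)
    σ ∈? G = Any.any? (Vec.≡-dec Bool._≟_ σ) G

  -- Up to a positive factor, z is the point where the segment from v to w meets f = 0.
  crossing : ∀ (f : LinearForm m) (as : Vec (LinearForm m) M) v w →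
    ¬ apply f v ≤ 0# → apply f w ≤ 0# → signs as v ≡ signs as w →
    ∃[ z ] apply f z ≈ 0# × signs as z ≡ signs as v
  crossing f as v w fv≰0 fw≤0 eq = z , fz≈0 ,
    ≡.trans (signs-combination as w v 0≤fv (λ fv≈0 → fv≰0 (≤-reflexive fv≈0))
                               (≤0⇒0≤- fw≤0) (≡.sym eq))
            (≡.sym eq)
    where
    z : Vector Carrier _
    z = combination (apply f v) w (- apply f w) v

    0≤fv : 0# ≤ apply f v
    0≤fv with ≤-total 0# (apply f v)
    ... | inj₁ 0≤fv = 0≤fv
    ... | inj₂ fv≤0 = contradiction fv≤0 fv≰0

    fz≈0 : apply f z ≈ 0#
    fz≈0 = begin-equality
      apply f z
        ≈⟨ apply-combinationʳ f (apply f v) w (- apply f w) v ⟩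
      apply f v * apply f w + - apply f w * apply f v
        ≈⟨ +-cong (*-comm _ _) (sym (-‿distribˡ-* _ _)) ⟩
      apply f w * apply f v - apply f w * apply f v
        ≈⟨ -‿inverseʳ _ ⟩
      0# ∎

  -- A sign vector of as extends in two ways only if it crosses f = 0, and those that
  -- do are listed in G′, one dimension lower; for the others side is the only choice.
  signVectors : ∀ (as : Vec (LinearForm m) M) →
    Σ[ G ∈ List (Vec Bool M) ]
      length G ℕ.≤ (1 ℕ.+ 2 ℕ.* M) ℕ.^ m × (∀ v → signs as v ∈ G)
  signVectors {m} [] = ([] ∷ []) , ℕ.≤-reflexive (≡.sym (ℕ.^-zeroˡ m)) , λ v → here ≡.refl
  signVectors {m} {suc M} (f ∷ as) with any? (λ p → ¬? (f p ≟ 0#)) | signVectors as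
  ... | no f≈0 | G , |G|≤ , covers =
    List.map (true ∷_) G ,
    ℕ.≤-trans (ℕ.≤-reflexive (length-map (true ∷_) G)) (ℕ.≤-trans |G|≤
      (ℕ.^-monoˡ-≤ m (ℕ.s≤s (ℕ.*-monoʳ-≤ 2 (ℕ.n≤1+n M))))) ,
    λ v → ≡.subst (λ b → b ∷ signs as v ∈ List.map (true ∷_) G)
            (≡.sym (nonPositive-true f v (≤-reflexive (apply-0 f v λ i →
              decidable-stable (f i ≟ 0#) λ fi≉0 → f≈0 (i , fi≉0)))))
            (∈-map⁺ (true ∷_) (covers v))
  signVectors {suc m} {suc M} (f ∷ as) | yes (p , fp≉0) | G , |G|≤ , covers
    with c , fp*c≈1 ← inverse (f p) fp≉0
    with G′ , |G′|≤ , covers′ ← signVectors (Vec.map (eliminate f p c fp*c≈1) as)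
    = G″ , |G″|≤ , covers″
    where
    Attained : Vec Bool M → Set
    Attained σ = ∃[ w ] apply f w ≤ 0# × signs as w ≡ σ

    -- Weak excluded middle only separates `¬ Attained σ` from its double negation, which is enough
    -- to choose the bit.
    side : Vec Bool M → Bool
    side σ with weak-excluded-middle (Attained σ)
    ... | inj₁ _ = false
    ... | inj₂ _ = true

    G″ : List (Vec Bool (suc M))
    G″ = List.map (λ σ → side σ ∷ σ) G List.++
         (List.map (true ∷_) G′ List.++ List.map (false ∷_) G′)

    |G″|≤ : length G″ ℕ.≤ (1 ℕ.+ 2 ℕ.* suc M) ℕ.^ suc m
    |G″|≤ = ℕ.≤-trans (ℕ.≤-reflexive length-G″)
      (ℕ.≤-trans (ℕ.+-mono-≤ |G|≤ (ℕ.+-mono-≤ |G′|≤ |G′|≤)) (cells-step M m))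
      where
      length-G″ : length G″ ≡ length G ℕ.+ (length G′ ℕ.+ length G′)
      length-G″ = ≡.trans (length-++ (List.map (λ σ → side σ ∷ σ) G))
        (≡.cong₂ ℕ._+_ (length-map _ G)
          (≡.trans (length-++ (List.map (true ∷_) G′))
            (≡.cong₂ ℕ._+_ (length-map _ G′) (length-map _ G′))))

    covers-crossed : ∀ v b → signs as v ∈ G′ → b ∷ signs as v ∈ G″
    covers-crossed v true  σ∈G′ =
      ∈-++⁺ʳ (List.map _ G) (∈-++⁺ˡ (∈-map⁺ (true ∷_) σ∈G′))
    covers-crossed v false σ∈G′ =
      ∈-++⁺ʳ (List.map _ G) (∈-++⁺ʳ (List.map (true ∷_) G′) (∈-map⁺ (false ∷_) σ∈G′))

    crossed : ∀ v → ¬ apply f v ≤ 0# → ¬ ¬ Attained (signs as v) → signs as v ∈ G′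
    -- Membership in a finite list of Boolean vectors is decidable, hence stable, so the double
    -- negation in front of `Attained` does no harm.
    crossed v fv≰0 ¬¬attained = decidable-stable (signs as v ∈? G′) λ σ∉G′ →
      ¬¬attained λ (w , fw≤0 , eq) →
        let z , fz≈0 , eq′ = crossing f as v w fv≰0 fw≤0 (≡.sym eq) in
        σ∉G′ (≡.subst (_∈ G′)
          (≡.trans (signs-eliminate f p c fp*c≈1 as z fz≈0) eq′)
          (covers′ (removeAt z p)))

    covers-uncrossed : ∀ v → side (signs as v) ∷ signs as v ∈ G″
    covers-uncrossed v = ∈-++⁺ˡ (∈-map⁺ (λ σ → side σ ∷ σ) (covers v))

    covers″ : ∀ v → signs (f ∷ as) v ∈ G″
    covers″ v with nonPositive f v in sign | side (signs as v) in eq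
    ... | true  | true  = ≡.subst (λ b → b ∷ signs as v ∈ G″) eq (covers-uncrossed v)
    ... | false | false = ≡.subst (λ b → b ∷ signs as v ∈ G″) eq (covers-uncrossed v)
    ... | true  | false with weak-excluded-middle (Attained (signs as v))
    ...   | inj₁ unattained =
      contradiction (v , nonPositive-true⁻ f v sign , ≡.refl) unattained
    -- The bit `true` was chosen because a point with `f ≤ 0` cannot be excluded; with `v` on the
    -- other side, the sign vector crosses `f = 0`.
    covers″ v | false | true with weak-excluded-middle (Attained (signs as v))
    ...   | inj₂ ¬¬attained = covers-crossed v false
              (crossed v (nonPositive-false⁻ f v sign) ¬¬attained)

  -- Decision trees with a specification.

  module _ {m : ℕ} where

    Input : Set
    Input = Vector Carrier m

    private
      variable
        c d : ℕ
        K K′ : Pred Input 0ℓ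
        Goal : A → Pred Input 0ℓ
        Goal′ : B → Pred Input 0ℓ

    -- A linear decision tree of depth at most c which, on the inputs
    -- satisfying K, reaches a result related to the input by Goal.
    data Decision {A : Set} (Goal : A → Pred Input 0ℓ) (K : Pred Input 0ℓ) : ℕ → Set₁ where
      return : (a : A) → (∀ v → K v → Goal a v) → Decision Goal K c
      ask    : (a : LinearForm m) →
               Decision Goal (λ v → K v × apply a v ≤ 0#) c →
               Decision Goal (λ v → K v × ¬ apply a v ≤ 0#) c →
               Decision Goal K (suc c)

    weaken : c ℕ.≤ d → (∀ v → K v → K′ v) → Decision Goal K′ c → Decision Goal K d
    weaken c≤d K⇒K′ (return a goal) = return a (λ v Kv → goal v (K⇒K′ v Kv))
    weaken (ℕ.s≤s c≤d) K⇒K′ (ask a t f) = ask a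
      (weaken c≤d (λ v (Kv , s) → K⇒K′ v Kv , s) t)
      (weaken c≤d (λ v (Kv , s) → K⇒K′ v Kv , s) f)

    infixl 1 _>>=_
    _>>=_ : Decision Goal K c → (∀ a → Decision Goal′ (λ v → K v × Goal a v) d) →
            Decision Goal′ K (c ℕ.+ d)
    return a goal >>= g = weaken (ℕ.m≤n+m _ _) (λ v Kv → Kv , goal v Kv) (g a)
    ask a t f     >>= g = ask a
      (t >>= λ b → weaken ℕ.≤-refl (λ v ((Kv , _) , gb) → Kv , gb) (g b))
      (f >>= λ b → weaken ℕ.≤-refl (λ v ((Kv , _) , gb) → Kv , gb) (g b))

    map : (f : A → B) → (∀ a v → K v → Goal a v → Goal′ (f a) v) →
          Decision Goal K c → Decision Goal′ K c
    map f goal⇒goal′ (return a goal) = return (f a) (λ v Kv → goal⇒goal′ a v Kv (goal v Kv))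
    map f goal⇒goal′ (ask a t e)     = ask a
      (map f (λ b v (Kv , _) → goal⇒goal′ b v Kv) t)
      (map f (λ b v (Kv , _) → goal⇒goal′ b v Kv) e)

    sequence : ∀ {n} {Goal : Fin n → A → Pred Input 0ℓ} →
               (∀ i → Decision (Goal i) K c) →
               Decision (λ (a : Vector A n) v → ∀ i → Goal i (a i) v) K (n ℕ.* c)
    sequence {n = zero}  D = return (λ ()) (λ v _ ())
    sequence {n = suc n} D = D zero >>= λ a →
      map (a Vector.∷_) (λ { as v (_ , goal) goals zero    → goal
                           ; as v (_ , goal) goals (suc i) → goals i })
          (weaken ℕ.≤-refl (λ v → proj₁) (sequence (D ∘ suc)))

    module _ {p : ℕ} {Goal : Vector (LinearForm m) p → Pred Input 0ℓ} where

      toTree : Decision Goal K c → Tree m p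
      toTree (return a _) = leaf a
      -- The negative and the zero branch share a subtree, as `ask` only separates `≤ 0` from its
      -- negation.
      toTree (ask a t f)  = test a (toTree t) (toTree t) (toTree f)

      depth-toTree : (D : Decision Goal K c) → depth (toTree D) ℕ.≤ c
      depth-toTree (return _ _) = ℕ.z≤n
      depth-toTree (ask a t f)  = ℕ.s≤s
        (ℕ.⊔-lub (ℕ.⊔-lub (depth-toTree t) (depth-toTree t)) (depth-toTree f))

      eval-toTree : (D : Decision Goal K c) → ∀ v → K v →
        ∃[ a ] Goal a v × (∀ j → eval (toTree D) v j ≡ apply (a j) v)
      eval-toTree (return a goal) v Kv = a , goal v Kv , λ j → ≡.refl
      eval-toTree (ask a t f) v Kv with <-compare (apply a v) 0#
      ... | tri< (av≤0 , _) _ _ = eval-toTree t v (Kv , av≤0)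
      ... | tri≈ _ av≈0 _       = eval-toTree t v (Kv , ≤-reflexive av≈0)
      ... | tri> _ av≉0 (0≤av , _) =
        eval-toTree f v (Kv , λ av≤0 → av≉0 (≤-antisym av≤0 0≤av))

    -- Minima and sorting by comparisons.

    module _ {E : Set} (form : E → LinearForm m) where

      value : E → Input → Carrier
      value e v = apply (form e) v

      Below : Input → Rel E 0ℓ
      Below v e s = value e v ≤ value s v

      compare : ∀ e s → Decision Goal (λ v → K v × Below v e s) c →
                        Decision Goal (λ v → K v × ¬ Below v e s) c →
                        Decision Goal K (suc c)
      compare e s t f = ask (form e ⊝ form s)
        (weaken ℕ.≤-refl (λ v (Kv , le) → Kv , apply-⊝-≤0⇒≤ (form e) (form s) v le) t)
        (weaken ℕ.≤-refl (λ v (Kv , ¬le) → Kv , ¬le ∘ ≤⇒apply-⊝-≤0 (form e) (form s) v) f)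

      -- The binary comparison is a parameter of cost `c`: within a block it is free, between block
      -- minima it is one test.
      minimal : (∀ i j → Decision (λ b v → Below v b i × Below v b j) K c) →
                ∀ {t} (f : Fin (suc t) → E) →
                Decision (λ b v → ∀ r → Below v b (f r)) K (t ℕ.* c)
      minimal min₂ {zero}  f = return (f zero) λ { v _ zero → ≤-refl }
      minimal {c = c} min₂ {suc t} f =
        weaken (ℕ.≤-reflexive (ℕ.+-comm (t ℕ.* c) c)) (λ v → id)
          (minimal min₂ (f ∘ suc) >>= λ b →
            map id (λ { a v (_ , b≤) (a≤f0 , a≤b) zero    → a≤f0
                      ; a v (_ , b≤) (a≤f0 , a≤b) (suc r) → ≤-trans a≤b (b≤ r) })
              (weaken ℕ.≤-refl (λ v → proj₁) (min₂ (f zero) b)))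

      Answers : Set
      Answers = E → E → Bool

      Consistent : Input → Pred Answers 0ℓ
      Consistent v σ = ∀ e s → σ e s ≡ nonPositive (form e ⊝ form s) v

      answering : E → E → Bool → List Answers → List Answers
      answering e s b = filter (λ σ → σ e s Bool.≟ b)

      compareWithHead : ∀ {Heavy : Pred E 0ℓ} e (x : Maybe E) → Maybe.All Heavy x →
        (∀ s → Heavy s → Decision Goal (λ v → K v × ¬ Below v e s) c) →
        Decision Goal (λ v → K v × Connected (Below v) (just e) x) c →
        Decision Goal K (suc c)
      compareWithHead e nothing _ above below =
        weaken (ℕ.n≤1+n _) (λ v Kv → Kv , just-nothing) below
      compareWithHead e (just s) (Maybe.just heavy) above below =
        compare e s (weaken ℕ.≤-refl (λ v (Kv , le) → Kv , just le) below) (above s heavy)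

      compareWithLast : ∀ {Light : Pred E 0ℓ} e (x : Maybe E) → Maybe.All Light x →
        (∀ s → Light s → Decision Goal (λ v → K v × Below v e s) c) →
        Decision Goal (λ v → K v × Connected (Below v) x (just e)) c →
        Decision Goal K (suc c)
      compareWithLast e nothing _ below above =
        weaken (ℕ.n≤1+n _) (λ v Kv → Kv , nothing-just) above
      compareWithLast {K = K} e (just s) (Maybe.just light) below above =
        compare e s (below s light) (weaken ℕ.≤-refl aboveLast above)
        where
        aboveLast : ∀ v → K v × ¬ Below v e s → K v × Connected (Below v) (just s) (just e)
        aboveLast v (Kv , ¬le) with ≤-total (value e v) (value s v)
        ... | inj₁ le = contradiction le ¬le
        ... | inj₂ ge = Kv , just ge

      -- In `sort` the cut is the predicted place of `e`: for a light `s` the outcome `e ≤ s` is the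
      -- surprise, for any other `s` the outcome `e > s`. At most two tests, against the neighbours
      -- of the cut, either confirm the place or end in a surprise, passed on to `below` or `above`.
      insertion : ∀ {Light : Pred E 0ℓ} → Decidable Light → ∀ e l →
        (∀ v → K v → Linked (Below v) l) →
        (∀ s → Light s → Decision Goal (λ v → K v × Below v e s) c) →
        (∀ s → ¬ Light s → Decision Goal (λ v → K v × ¬ Below v e s) c) →
        (∀ l′ → e ∷ l ⊆ l′ → Decision Goal (λ v → K v × Linked (Below v) l′) c) →
        Decision Goal K (2 ℕ.+ c)
      insertion Light? e l sorted below above inserted with cut Light? l
      ... | pre , post , ≡.refl , light , heavy =
        compareWithLast e (last pre) light
          (λ s light → weaken (ℕ.n≤1+n _) (λ v → id) (below s light))
          (compareWithHead e (head post) heavy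
            (λ s heavy → weaken ℕ.≤-refl (λ v ((Kv , _) , ¬le) → Kv , ¬le) (above s heavy))
            (weaken ℕ.≤-refl
              (λ v ((Kv , before) , after) → Kv ,
                let sorted-pre , sorted-post = Linked-++⁻ pre (sorted v Kv) in
                Linked.++⁺ sorted-pre before (after Linked.∷′ sorted-post))
              (inserted (pre ++ e ∷ post) (insert-⊆ e pre))))

      sort : ∀ k (candidates : List Answers) → length candidates ℕ.< 2 ℕ.^ k → ∀ todo sorted →
        (∀ v → K v → Any (Consistent v) candidates) →
        (∀ v → K v → Linked (Below v) sorted) →
        Decision {A = ∃[ l ] (todo ⊆ l × sorted ⊆ l)} (λ (l , _) v → Linked (Below v) l)
          K ((length todo ℕ.+ k) ℕ.* 2)
      sort k G |G|< [] l consistent sorted = return (l , (λ ()) , id) sorted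
      -- Fewer than `2 ^ 0` candidates means none, so no input satisfies `K` and any list containing
      -- the elements will do.
      sort zero [] |G|< (e ∷ todo) l consistent sorted =
        return (e ∷ todo ++ l , ∈-++⁺ˡ , ∈-++⁺ʳ (e ∷ todo))
          (λ v Kv → contradiction (consistent v Kv) λ ())
      sort zero (_ ∷ _) (ℕ.s≤s ()) (e ∷ todo) l consistent sorted
      sort {K = K} (suc k) G |G|< (e ∷ todo) l consistent sorted =
        insertion Light? e l sorted
          (λ s light → weaken cost-≤ (λ v → id)
            (sort k (answering e s true G) light (e ∷ todo) l
              (λ v (Kv , le) → restrict v s true (consistent v Kv)
                (nonPositive-true (form e ⊝ form s) v
                  (≤⇒apply-⊝-≤0 (form e) (form s) v le)))
              (λ v (Kv , _) → sorted v Kv)))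
          (λ s heavy → weaken cost-≤ (λ v → id)
            (sort k (answering e s false G) (other-light s heavy) (e ∷ todo) l
              (λ v (Kv , ¬le) → restrict v s false (consistent v Kv)
                (nonPositive-false (form e ⊝ form s) v
                  (¬le ∘ apply-⊝-≤0⇒≤ (form e) (form s) v)))
              (λ v (Kv , _) → sorted v Kv)))
          (λ l′ el⊆l′ → map
            (λ (l″ , todo⊆l″ , l′⊆l″) → l″ ,
              (λ { (here ≡.refl) → l′⊆l″ (el⊆l′ (here ≡.refl))
                 ; (there x∈) → todo⊆l″ x∈ }) ,
              l′⊆l″ ∘ el⊆l′ ∘ there)
            (λ _ _ _ → id)
            (sort (suc k) G |G|< todo l′
              (λ v (Kv , _) → consistent v Kv) (λ v → proj₂)))
        where
        Light : Pred E 0ℓ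
        Light s = length (answering e s true G) ℕ.< 2 ℕ.^ k

        Light? : Decidable Light
        Light? s = length (answering e s true G) ℕ.<? 2 ℕ.^ k

        cost-≤ : (length (e ∷ todo) ℕ.+ k) ℕ.* 2 ℕ.≤ (length todo ℕ.+ suc k) ℕ.* 2
        cost-≤ = ℕ.*-monoˡ-≤ 2 (ℕ.≤-reflexive (≡.sym (ℕ.+-suc (length todo) k)))

        -- `G` has fewer than `2 ^ suc k` elements, so `2 ^ k` or more for one answer leave fewer
        -- than `2 ^ k` for the other.
        other-light : ∀ s → ¬ Light s → length (answering e s false G) ℕ.< 2 ℕ.^ k
        other-light s heavy = ℕ.+-cancelˡ-< (2 ℕ.^ k) _ _ (ℕ.≤-<-trans
          (ℕ.+-monoˡ-≤ (length (answering e s false G)) (ℕ.≮⇒≥ heavy))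
          (≡.subst₂ ℕ._<_
            (≡.sym (length-filter-true-false (λ σ → σ e s) G))
            (≡.cong (2 ℕ.^ k ℕ.+_) (ℕ.+-identityʳ (2 ℕ.^ k)))
            |G|<))

        restrict : ∀ v s b → Any (Consistent v) G → nonPositive (form e ⊝ form s) v ≡ b →
                   Any (Consistent v) (answering e s b G)
        restrict v s b any eq with σ , σ∈G , consistent ← find any =
          lose (∈-filter⁺ (λ σ → σ e s Bool.≟ b) σ∈G (≡.trans (consistent e s) eq)) consistent

  -- An order is represented by its full table of comparisons. Each entry is the sign of one of the
  -- `N * N` differences of forms, so the tables that occur are among the sign vectors of this
  -- family.
  candidates : ∀ {m N} (form : Fin N → LinearForm m) →
    Σ[ G ∈ List (Answers form) ] length G ℕ.≤ (1 ℕ.+ 2 ℕ.* (N ℕ.* N)) ℕ.^ m ×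
      (∀ v → Any (Consistent form v) G)
  candidates {m} {N} form =
    let G , |G|≤ , covers = signVectors (Vec.tabulate difference) in
    List.map answers G ,
    ℕ.≤-trans (ℕ.≤-reflexive (length-map answers G)) |G|≤ ,
    λ v → Any.map⁺ (Any.map (λ {σ} → consistent v {σ}) (covers v))
    where
    difference : Fin (N ℕ.* N) → LinearForm m
    difference q = let e , s = remQuot N q in form e ⊝ form s

    answers : Vec Bool (N ℕ.* N) → Answers form
    answers σ e s = Vec.lookup σ (combine e s)

    consistent : ∀ v {σ} → signs (Vec.tabulate difference) v ≡ σ →
                 Consistent form v (answers σ)
    consistent v ≡.refl e s = ≡.trans
      (Vec.lookup-map (combine e s) (λ a → nonPositive a v) (Vec.tabulate difference))
      (≡.cong (λ a → nonPositive a v)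
        (≡.trans (Vec.lookup∘tabulate difference (combine e s))
          (≡.cong (λ (e , s) → form e ⊝ form s) (remQuot-combine e s))))

  -- Minima, Fredman's exchange and the square root.

  minimum-unique : ∀ {m} (f : Vector Carrier (suc m)) {z} b → z ≈ f b → (∀ i → z ≤ f i) →
                   z ≈ minimum f
  minimum-unique f {z} b z≈fb z≤f = ≤-antisym
    (Extrema.v≤min⁺ totalOrder (z≤f zero) (All.tabulate⁺ (z≤f ∘ suc)))
    (≤-respʳ-≈ (sym z≈fb) (minimum≤ b))
    where
    minimum≤ : ∀ i → minimum f ≤ f i
    minimum≤ zero    = Extrema.min≤⊤ totalOrder (f zero) (List.tabulate (f ∘ suc))
    minimum≤ (suc i) = All.tabulate⁻
      (Extrema.min≤xs totalOrder (f zero) (List.tabulate (f ∘ suc))) i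

  telescope : ∀ x y z → (x - y) + (y - z) ≈ x - z
  telescope x y z = begin-equality
    (x - y) + (y - z)      ≈⟨ +-assoc x (- y) (y - z) ⟩
    x + (- y + (y - z))    ≈⟨ +-congˡ (+-assoc (- y) y (- z)) ⟨
    x + ((- y + y) - z)    ≈⟨ +-congˡ (+-congʳ (-‿inverseˡ y)) ⟩
    x + (0# - z)           ≈⟨ +-congˡ (+-identityˡ (- z)) ⟩
    x - z                  ∎

  -- Add `b - c`. With `a`, `b` from `x` and `c`, `d` the matching entries of `y`, an order of
  -- differences within each vector becomes an order of candidates. `exchange₂` serves the opposite
  -- outcome, with the `y` difference on the left.
  exchange₁ : ∀ {a b c d} → a - b ≤ c - d → a - c ≤ b - d
  exchange₁ {a} {b} {c} {d} le = begin
    a - c              ≈⟨ telescope a b c ⟨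
    (a - b) + (b - c)  ≤⟨ +-monoˡ-≤ (b - c) le ⟩
    (c - d) + (b - c)  ≈⟨ +-comm (c - d) (b - c) ⟩
    (b - c) + (c - d)  ≈⟨ telescope b c d ⟩
    b - d              ∎

  exchange₂ : ∀ {a b c d} → a - b ≤ c - d → d - b ≤ c - a
  exchange₂ {a} {b} {c} {d} le = begin
    d - b              ≈⟨ telescope d a b ⟨
    (d - a) + (a - b)  ≈⟨ +-comm (d - a) (a - b) ⟩
    (a - b) + (d - a)  ≤⟨ +-monoˡ-≤ (d - a) le ⟩
    (c - d) + (d - a)  ≈⟨ telescope c d a ⟩
    c - a              ∎

  fromℕ-mono-≤ : ∀ {m n} → m ℕ.≤ n → fromℕ m ≤ fromℕ n
  fromℕ-mono-≤ {n = zero}  ℕ.z≤n       = ≤-refl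
  fromℕ-mono-≤ {n = suc n} ℕ.z≤n       = begin
    0#            ≈⟨ +-identityˡ 0# ⟨
    0# + 0#       ≤⟨ +-mono-≤ 0≤1 (fromℕ-mono-≤ {n = n} ℕ.z≤n) ⟩
    1# + fromℕ n  ∎
  fromℕ-mono-≤ (ℕ.s≤s m≤n) = +-mono-≤ ≤-refl (fromℕ-mono-≤ m≤n)

  0≤fromℕ : ∀ n → 0# ≤ fromℕ n
  0≤fromℕ n = fromℕ-mono-≤ {n = n} ℕ.z≤n

  *-monoˡ-≤ : ∀ {x y z} → 0# ≤ x → y ≤ z → x * y ≤ x * z
  *-monoˡ-≤ {x} {y} {z} 0≤x y≤z = -≤0⇒≤ (begin
    x * y - x * z    ≈⟨ x[y-z]≈xy-xz x y z ⟨
    x * (y - z)      ≤⟨ *-nonPositive 0≤x (≤⇒-≤0 y≤z) ⟩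
    0#               ∎)

  fromℕ≤√ : ∀ {t n} → t ℕ.* t ℕ.≤ n → fromℕ t ≤ √ n
  fromℕ≤√ {t} {n} t²≤n =
    proj₁ (proj₂ (complete (SquareAtMost n) (squareAtMost-nonempty n) (squareAtMost-bounded n)))
      (fromℕ t) (begin
        fromℕ t * fromℕ t  ≈⟨ ×1-homo-* t t ⟨
        fromℕ (t ℕ.* t)    ≤⟨ fromℕ-mono-≤ t²≤n ⟩
        fromℕ n            ∎)

  module _ {m : ℕ} {E : Set} (form : E → LinearForm m) where

    lesser : ∀ {K : Pred (Vector Carrier m) 0ℓ} i j →
      Decision (λ b v → Below form v b i × Below form v b j) K 1
    lesser i j = compare form i j
      (return i λ v (_ , i≤j) → ≤-refl , i≤j)
      (return j λ v (_ , i≰j) →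
        [ (λ i≤j → contradiction i≤j i≰j) , id ]′ (≤-total _ _) , ≤-refl)

    -- The disjunction stands outside the quantifier over inputs, so the winner is fixed when the
    -- tree is built and no test is spent.
    staticLesser : ∀ {K : Pred (Vector Carrier m) 0ℓ} {i j} →
      (∀ v → K v → Below form v i j) ⊎ (∀ v → K v → Below form v j i) →
      Decision (λ b v → Below form v b i × Below form v b j) K 0
    staticLesser {i = i} (inj₁ i≤j) = return i λ v Kv → ≤-refl , i≤j v Kv
    staticLesser {j = j} (inj₂ j≤i) = return j λ v Kv → j≤i v Kv , ≤-refl

  apply-unit-⊝ : ∀ {m} (a b : Fin m) v → apply (unit a ⊝ unit b) v ≈ v a - v b
  apply-unit-⊝ a b v = trans (apply-⊝ (unit a) (unit b) v)
    (+-cong (apply-unit a v) (-‿cong (apply-unit b v)))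

  -- The decision tree for the convolution.

  module _ (n t : ℕ) (n≤s² : n ℕ.≤ suc t ℕ.* suc t) where

    private
      s : ℕ
      s = suc t

      In : Set
      In = Vector Carrier (n ℕ.+ n)

    -- Indexing by all pairs of inputs gives one plain `Fin` for `x` and `y` differences alike; the
    -- number of hyperplanes stays polynomial in `n`, as `entropy` requires.
    pairDifference : Fin (pairs n) → LinearForm (n ℕ.+ n)
    pairDifference e = let a , b = remQuot (n ℕ.+ n) e in unit a ⊝ unit b

    value-combine : ∀ (a b : Fin (n ℕ.+ n)) v →
      value pairDifference (combine a b) v ≈ v a - v b
    value-combine a b v = trans
      (reflexive (≡.cong (λ (a , b) → apply (unit a ⊝ unit b) v) (remQuot-combine a b)))
      (apply-unit-⊝ a b v)

    pair-≤ : ∀ v (a b c d : Fin (n ℕ.+ n)) →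
      Below pairDifference v (combine a b) (combine c d) → v a - v b ≤ v c - v d
    pair-≤ v a b c d le =
      ≤-respˡ-≈ (value-combine a b v) (≤-respʳ-≈ (value-combine c d v) le)

    candidate : ∀ (k : Fin n) → Fin (suc (toℕ k)) → LinearForm (n ℕ.+ n)
    candidate k i =
      unit (inject≤ i (toℕ<n k) ↑ˡ n) ⊝ unit (n ↑ʳ inject≤ (opposite i) (toℕ<n k))

    value-candidate : ∀ (x y : Vector Carrier n) k i →
      value (candidate k) i (x Vector.++ y) ≈
      x (inject≤ i (toℕ<n k)) - y (inject≤ (opposite i) (toℕ<n k))
    value-candidate x y k i = trans
      (apply-unit-⊝ (inject≤ i (toℕ<n k) ↑ˡ n)
                    (n ↑ʳ inject≤ (opposite i) (toℕ<n k)) (x Vector.++ y))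
      (+-cong (reflexive (lookup-++ˡ x y _)) (-‿cong (reflexive (lookup-++ʳ x y _))))

    -- The witness `b` records that the output form is itself a candidate, so its value is attained
    -- and not only a lower bound.
    Minimizes : (k : Fin n) → LinearForm (n ℕ.+ n) → Pred In 0ℓ
    Minimizes k a v = ∃[ b ] a ≡ candidate k b × (∀ i → apply a v ≤ value (candidate k) i v)

    xPair yPair : Fin n × Fin n → Fin (pairs n)
    xPair (i , j) = combine (i ↑ˡ n) (j ↑ˡ n)
    yPair (i , j) = combine (n ↑ʳ i) (n ↑ʳ j)

    xDifferences yDifferences nearDifferences : List (Fin (pairs n))
    xDifferences = List.map xPair (nearPairs s)
    yDifferences = List.map yPair (nearPairs s)
    nearDifferences = xDifferences ++ yDifferences

    length-nearDifferences :
      length nearDifferences ≡ n ℕ.* (s ℕ.+ s) ℕ.+ n ℕ.* (s ℕ.+ s)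
    length-nearDifferences = ≡.trans (length-++ xDifferences)
      (≡.cong₂ ℕ._+_
        (≡.trans (length-map xPair (nearPairs s)) (length-nearPairs {n} s))
        (≡.trans (length-map yPair (nearPairs s)) (length-nearPairs {n} s)))

    sortNearDifferences :
      Decision {A = ∃[ l ] nearDifferences ⊆ l × [] ⊆ l}
               (λ (l , _) v → Linked (Below pairDifference v) l) (λ _ → ⊤)
               ((length nearDifferences ℕ.+ entropy n s) ℕ.* 2)
    sortNearDifferences =
      let G , |G|≤ , consistent = candidates pairDifference in
      sort pairDifference (entropy n s) G (ℕ.≤-<-trans |G|≤ (cells<2^entropy n s n≤s²))
        nearDifferences [] (λ v _ → consistent v) (λ _ _ → [])

    module _ {l : List (Fin (pairs n))} (near⊆l : nearDifferences ⊆ l) where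

      Sorted : Pred In 0ℓ
      Sorted v = ⊤ × Linked (Below pairDifference v) l

      -- The `x` difference for `i`, `i′` and the `y` difference for the reflected indices both
      -- occur in `l`. Their positions settle the order for all inputs sorted by `l` at once, and
      -- the exchange turns it into an order of candidates.
      near-candidates : ∀ (k : Fin n) i i′ → Near s (toℕ i) (toℕ i′) →
        (∀ v → Sorted v → Below (candidate k) v i i′) ⊎
        (∀ v → Sorted v → Below (candidate k) v i′ i)
      near-candidates k i i′ near =
        [ (λ le → inj₁ λ v → forward v ∘ le (Below pairDifference v) ≤-refl ≤-trans ∘ proj₂)
        , (λ ge → inj₂ λ v → backward v ∘ ge (Below pairDifference v) ≤-refl ≤-trans ∘ proj₂) ]′
        (Linked-compare l
          (near⊆l (∈-++⁺ˡ (∈-map⁺ xPair x-near)))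
          (near⊆l (∈-++⁺ʳ xDifferences (∈-map⁺ yPair y-near))))
        where
        index : Fin (suc (toℕ k)) → Fin n
        index i = inject≤ i (toℕ<n k)

        x-near : (index i , index i′) ∈ nearPairs s
        x-near = ∈-nearPairs s (≡.subst₂ (Near s)
          (≡.sym (toℕ-inject≤ i (toℕ<n k))) (≡.sym (toℕ-inject≤ i′ (toℕ<n k))) near)

        toℕ-opposite : ∀ i → toℕ (index (opposite i)) ≡ toℕ k ℕ.∸ toℕ i
        toℕ-opposite i = ≡.trans (toℕ-inject≤ (opposite i) (toℕ<n k)) (opposite-prop i)

        y-near : (index (opposite i) , index (opposite i′)) ∈ nearPairs s
        y-near = ∈-nearPairs s (≡.subst₂ (Near s)
          (≡.sym (toℕ-opposite i)) (≡.sym (toℕ-opposite i′))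
          (Near-∸ (toℕ≤pred[n] i) (toℕ≤pred[n] i′) near))

        p q : Fin (suc (toℕ k)) → Fin (n ℕ.+ n)
        p i = index i ↑ˡ n
        q i = n ↑ʳ index (opposite i)

        forward : ∀ v → Below pairDifference v (combine (p i) (p i′)) (combine (q i) (q i′)) →
                  Below (candidate k) v i i′
        forward v le = begin
          value (candidate k) i v   ≈⟨ apply-unit-⊝ (p i) (q i) v ⟩
          v (p i) - v (q i)         ≤⟨ exchange₁ (pair-≤ v (p i) (p i′) (q i) (q i′) le) ⟩
          v (p i′) - v (q i′)       ≈⟨ apply-unit-⊝ (p i′) (q i′) v ⟨
          value (candidate k) i′ v  ∎

        backward : ∀ v → Below pairDifference v (combine (q i) (q i′)) (combine (p i) (p i′)) →
                   Below (candidate k) v i′ i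
        backward v le = begin
          value (candidate k) i′ v  ≈⟨ apply-unit-⊝ (p i′) (q i′) v ⟩
          v (p i′) - v (q i′)       ≤⟨ exchange₂ (pair-≤ v (q i) (q i′) (p i) (p i′) le) ⟩
          v (p i) - v (q i)         ≈⟨ apply-unit-⊝ (p i) (q i) v ⟨
          value (candidate k) i v   ∎

      entryDecision : (k : Fin n) → Decision (Minimizes k) Sorted t
      entryDecision k = weaken cost≤t (λ v → id)
        (sequence (λ q → minimal (candidate k ∘ block q)
          (λ r r′ → staticLesser (candidate k ∘ block q)
            (near-candidates k (block q r) (block q r′) (block-near q r r′)))
          id)
        >>= λ best → map (candidate k) (minimizes best)
              (minimal (candidate k) (lesser (candidate k)) (λ q → block q (best q))))
        where
        cost≤t : s ℕ.* (t ℕ.* 0) ℕ.+ t ℕ.* 1 ℕ.≤ t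
        -- The block minima cost nothing, and choosing among `s = suc t` of them takes `t` tests.
        cost≤t = ℕ.≤-reflexive (≡.cong₂ ℕ._+_
          (≡.trans (≡.cong (s ℕ.*_) (ℕ.*-zeroʳ t)) (ℕ.*-zeroʳ s)) (ℕ.*-identityʳ t))

        minimizes : ∀ (best : Vector (Fin s) s) b v →
          Sorted v × (∀ q r → Below (candidate k) v (block q (best q)) (block q r)) →
          (∀ q → Below (candidate k) v b (block q (best q))) → Minimizes k (candidate k b) v
        minimizes best b v (_ , best≤) b≤ = b , ≡.refl , λ i →
          let q , r , eq = block-surjective (ℕ.<-≤-trans (toℕ<n k) n≤s²) i in
          ≡.subst (Below (candidate k) v b) eq (≤-trans (b≤ q) (best≤ q r))

    convolutionDecision :
      Decision (λ (a : Vector (LinearForm (n ℕ.+ n)) n) v → ∀ k → Minimizes k (a k) v)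
               (λ _ → ⊤) (cost n t)
    convolutionDecision =
      weaken (ℕ.≤-reflexive (≡.cong (λ c → (c ℕ.+ entropy n s) ℕ.* 2 ℕ.+ n ℕ.* t)
                                    length-nearDifferences))
             (λ v → id)
             (sortNearDifferences >>= λ (l , near⊆l , _) → sequence (entryDecision near⊆l))

    minimizes-minusConvolution : ∀ x y k a → Minimizes k a (x Vector.++ y) →
      apply a (x Vector.++ y) ≈ minusConvolution x y k
    minimizes-minusConvolution x y k a (b , ≡.refl , a≤) = minimum-unique
      (λ i → x (inject≤ i (toℕ<n k)) - y (inject≤ (opposite i) (toℕ<n k))) b
      (value-candidate x y k b)
      (λ i → ≤-respʳ-≈ (value-candidate x y k i) (a≤ i))

    computes : Computes₂ (toTree convolutionDecision) minusConvolution
    computes x y k =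
      let a , minimizes , eval≡ = eval-toTree convolutionDecision (x Vector.++ y) tt in
      trans (reflexive (eval≡ k)) (minimizes-minusConvolution x y k (a k) (minimizes k))

  √-bound : ∀ {f n t} → 1 ℕ.≤ n → t ℕ.* t ℕ.≤ n → n ℕ.< suc t ℕ.* suc t → f ℕ.≤ cost n t →
            fromℕ f ≤ fromℕ 107 * (fromℕ n * √ n)
  -- `t = 0` would force `n < 1`; hence `t` is positive, as `cost≤` requires.
  √-bound {n = suc n} {t = zero} 1≤n t²≤n (ℕ.s≤s ()) f≤
  √-bound {f} {n} {t@(suc _)} 1≤n t²≤n _ f≤ = begin
    fromℕ f
      ≤⟨ fromℕ-mono-≤ (ℕ.≤-trans f≤ (cost≤ n t 1≤n (ℕ.s≤s ℕ.z≤n))) ⟩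
    fromℕ (107 ℕ.* (n ℕ.* t))
      ≈⟨ ×1-homo-* 107 (n ℕ.* t) ⟩
    fromℕ 107 * fromℕ (n ℕ.* t)
      ≈⟨ *-congˡ (×1-homo-* n t) ⟩
    fromℕ 107 * (fromℕ n * fromℕ t)
      ≤⟨ *-monoˡ-≤ (0≤fromℕ 107) (*-monoˡ-≤ (0≤fromℕ n) (fromℕ≤√ {t} {n} t²≤n)) ⟩
    fromℕ 107 * (fromℕ n * √ n) ∎

theorem4 : (ℝ : Reals) →
  let open Reals ℝ
      open SquareRoot ℝ
      open Asymptotics ℝ
      open MinConvolution ℝ
      open LinearDecisionTree ℝ
  in Σ[ T ∈ ((n : ℕ) → Tree (n ℕ.+ n) n) ]
       (∀ n → Computes₂ (T n) minusConvolution)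
       × (λ n → depth (T n)) ∈O (λ n → fromℕ n * √ n)
theorem4 ℝ =
  (λ n → toTree ℝ (decision n)) ,
  (λ n → let t , _ , n<s² = integerSqrt n in computes ℝ n t (ℕ.<⇒≤ n<s²)) ,
  fromℕ 107 , 1 , λ n 1≤n → let t , t²≤n , n<s² = integerSqrt n in
    √-bound ℝ 1≤n t²≤n n<s² (depth-toTree ℝ (decision n))
  where
  open Reals ℝ using (fromℕ)
  -- `t` is the integer square root: `n < suc t * suc t` makes `suc t` blocks suffice, and
  -- `t * t ≤ n` turns a bound in `t` into one in `√ n`.
  decision = λ n → let t , _ , n<s² = integerSqrt n in
    convolutionDecision ℝ n t (ℕ.<⇒≤ n<s²)
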